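{- Let $D$ be a strong semicomplete multipartite digraph with $n$ vertices. If $d(u)+d(v)\geq 2n-3$ for every pair of dominated nonadjacent vertices $\{u,v\}$ of $D$, then $D$ is supereulerian.
   Context: All digraphs are finite, loopless and without parallel arcs (a pair of opposite arcs $(x,y),(y,x)$ is allowed). $(w,z)$ denotes an arc from $w$ to $z$. For a vertex $x$, $d(x)=d^-(x)+d^+(x)$ is the sum of its in-degree and out-degree. Two distinct vertices $u,v$ are nonadjacent if neither $(u,v)$ nor $(v,u)$ is an arc. A pair $\{u,v\}$ is dominated if there is a vertex $w$ with $(w,u),(w,v)\in A(D)$. A digraph is strong if every vertex is reachable from every other vertex by a directed path. A digraph is supereulerian if it contains a closed directed trail (a closed walk with no repeated arcs) passing through every vertex, i.e. it has a spanning eulerian subdigraph. A semicomplete multipartite digraph is a biorientation of a complete multipartite graph, i.e. it is obtained from a complete multipartite graph by replacing each edge $xy$ by $(x,y)$, by $(y,x)$, or by both arcs. -}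

module Defs where

open import Data.Nat using (ℕ; _+_)
open import Data.Bool using (Bool; true; false; if_then_else_)
open import Data.Fin using (Fin)
open import Data.List using (List; []; _∷_; map; allFin)
open import Data.Nat.ListAction using (sum)
open import Data.List.Relation.Unary.All using (All)
open import Data.List.Relation.Unary.Unique.Propositional using (Unique)
open import Data.List.Membership.Propositional using (_∈_)
open import Data.Product using (_×_; _,_; Σ; ∃)
open import Relation.Binary.PropositionalEquality using (_≡_; _≢_)

-- A digraph on vertex set Fin n: arc x y = true iff (x,y) is an arc.
-- Loopless; no parallel arcs is automatic (arcs form a relation).
record Digraph (n : ℕ) : Set where
  field
    arc      : Fin n → Fin n → Bool
    loopless : ∀ x → arc x x ≡ false

module _ {n : ℕ} (D : Digraph n) where
  open Digraph D

  Arc : Fin n → Fin n → Set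
  Arc x y = arc x y ≡ true

  outdeg : Fin n → ℕ
  outdeg x = sum (map (λ y → if arc x y then 1 else 0) (allFin n))

  indeg : Fin n → ℕ
  indeg x = sum (map (λ y → if arc y x then 1 else 0) (allFin n))

  deg : Fin n → ℕ
  deg x = indeg x + outdeg x

  Nonadjacent : Fin n → Fin n → Set
  Nonadjacent u v = u ≢ v × arc u v ≡ false × arc v u ≡ false

  Dominated : Fin n → Fin n → Set
  Dominated u v = ∃ λ w → Arc w u × Arc w v

  data Reach : Fin n → Fin n → Set where
    here : ∀ {x} → Reach x x
    step : ∀ {x y z} → Arc x y → Reach y z → Reach x z

  Strong : Set
  Strong = ∀ x y → Reach x y

  SemicompleteMultipartite : Set
  SemicompleteMultipartite =
    Σ (Fin n → ℕ) λ part →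
      (∀ x y → x ≢ y → part x ≡ part y → arc x y ≡ false × arc y x ≡ false)
      × (∀ x y → part x ≢ part y → (arc x y ≡ true) Data.Sum.⊎ (arc y x ≡ true))
    where import Data.Sum

  -- a walk starting at x visiting the vertex list ws in order
  arcsOf : Fin n → List (Fin n) → List (Fin n × Fin n)
  arcsOf x []       = []
  arcsOf x (y ∷ ys) = (x , y) ∷ arcsOf y ys

  endpoint : Fin n → List (Fin n) → Fin n
  endpoint x []       = x
  endpoint x (y ∷ ys) = endpoint y ys

  ClosedTrail : Fin n → List (Fin n) → Set
  ClosedTrail x ws =
    All (λ p → Arc (Data.Product.proj₁ p) (Data.Product.proj₂ p)) (arcsOf x ws)
    × Unique (arcsOf x ws)
    × endpoint x ws ≡ x
    where import Data.Product

  Supereulerian : Set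
  Supereulerian =
    Σ (Fin n) λ x → Σ (List (Fin n)) λ ws →
      ClosedTrail x ws × (∀ v → v ∈ (x ∷ ws))

{-# OPTIONS --safe #-}
-- An eulerian factor (a set of arcs with equal positive in- and out-degree at every vertex) is built
-- by augmenting flows that cover one more vertex y at a time. If no residual path exists, the
-- reachable residual nodes split the vertices into R₁, R₂ and a set Y ∋ y carrying little flow, with
-- all arcs from Y ∪ R₂ to Y ∪ R₁ used. Counting these arcs and strong connectivity yield another
-- u ∈ Y nonadjacent to y and dominated together with it, of so small a degree that the hypothesis fails.
--
-- A factor decomposes into closed trails, which are merged until one is left. If every vertex
-- has an arc into another trail, a cycle of such arcs merges at least two trails. Otherwise some
-- vertex has none, and by strong connectivity some trail contains an arc (u , s) such that s has none
-- but u does, say to b; adjacency in a multipartite digraph then lets the trail of b be inserted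
-- between u and s.
module Submission where

import Data.Nat.Properties as ℕ
open import Algebra.Properties.Semiring.Sum ℕ.+-*-semiring
  using (sum; ∑-distrib-+; ∑-comm; *-distribˡ-sum; sum-cong-≗; sum-replicate-zero)
open import Data.Bool using (Bool; true; false; if_then_else_; _∧_; _∨_; not)
  renaming (_≟_ to _≟B_)
open import Data.Fin using (Fin; zero; suc; toℕ)
open import Data.Fin.Properties using (any?; all?; pigeonhole; ¬∀⟶∃¬) renaming (_≟_ to _≟F_)
open import Data.List using (List; []; _∷_; _++_; [_]; length; map; concat; allFin; tabulate)
open import Data.List.Membership.Propositional using (_∈_; _∉_; find; lose)
open import Data.List.Membership.Propositional.Properties
  using (∈-++⁺ˡ; ∈-++⁺ʳ; ∈-++⁻; ∈-∃++; ∈-concat⁻′; ∈-map⁺; ∈-allFin)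
open import Data.List.Properties using (length-++; map-tabulate; ++-assoc; ++-identityʳ)
open import Data.List.Relation.Binary.Permutation.Propositional
  using (_↭_; ↭-refl; ↭-sym; ↭-trans; ↭-reflexive; ↭-prep; ↭-swap; ↭⇒↭ₛ)
open import Data.List.Relation.Binary.Permutation.Propositional.Properties
  using (shift; shifts; ∈-resp-↭; Any-resp-↭; All-resp-↭; ↭-length; ++⁺; ++⁺ˡ; ++⁺ʳ)
  renaming (++-comm to ++-comm-↭)
import Data.List.Relation.Binary.Permutation.Setoid.Properties as PermutationSetoid
open import Data.List.Relation.Unary.All using (All; []; _∷_)
import Data.List.Relation.Unary.All as All
open import Data.List.Relation.Unary.AllPairs using (AllPairs; []; _∷_)
import Data.List.Relation.Unary.AllPairs as AllPairs
open import Data.List.Relation.Unary.Any using (Any; here; there) renaming (any? to anyElem?)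
open import Data.List.Relation.Unary.Unique.Propositional using (Unique)
import Data.List.Relation.Unary.Unique.Propositional.Properties as Unique
open import Data.Nat
  using (ℕ; zero; suc; _+_; _*_; _∸_; _≤_; _<_; z≤n; s≤s; _≤?_; _<?_; _≤′_; ≤′-refl; ≤′-step)
  renaming (_≟_ to _≟ℕ_)
import Data.Nat.ListAction as ListAction
open import Data.Nat.Properties
open import Data.Nat.Solver using (module +-*-Solver)
open import Data.Product using (_×_; _,_; ∃; ∃₂; proj₁; proj₂)
open import Data.Sum using (_⊎_; inj₁; inj₂)
open import Defs
open import Function using (_∘_; id)
open import Level using (0ℓ)
open import Relation.Binary using (Rel; Decidable; DecidableEquality)
open import Relation.Binary.Construct.Closure.ReflexiveTransitive using (Star; ε; _◅_; _◅◅_)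
open import Relation.Binary.PropositionalEquality
  using (_≡_; _≢_; refl; sym; trans; cong; cong₂; subst; ≢-sym; setoid; module ≡-Reasoning)
open import Relation.Nullary using (¬_; Dec; yes; no; does; contradiction)
open import Relation.Nullary.Decidable using (map′; _×-dec_; _⊎-dec_; ¬?; dec-true; dec-false)

-- Indicators and finite sums.

⟦_⟧ : Bool → ℕ
⟦ b ⟧ = if b then 1 else 0

δ : ∀ {n} → Fin n → Fin n → ℕ
δ x y = ⟦ does (x ≟F y) ⟧

δ-refl : ∀ {n} (x : Fin n) → δ x x ≡ 1
δ-refl x rewrite dec-true (x ≟F x) refl = refl

δ-≢ : ∀ {n} {x y : Fin n} → x ≢ y → δ x y ≡ 0
δ-≢ {x = x} {y} x≢y rewrite dec-false (x ≟F y) x≢y = refl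

sum-δ : ∀ {n} (x : Fin n) → sum (λ y → δ y x) ≡ 1
sum-δ {suc n} zero    = cong suc (sum-replicate-zero n)
sum-δ {suc n} (suc x) = sum-δ x

sum-mono : ∀ {n} {f g : Fin n → ℕ} → (∀ i → f i ≤ g i) → sum f ≤ sum g
sum-mono {zero}  f≤g = z≤n
sum-mono {suc n} f≤g = +-mono-≤ (f≤g zero) (sum-mono (f≤g ∘ suc))

sum-mono-< : ∀ {n} {f g : Fin n → ℕ} → (∀ i → f i ≤ g i) → ∀ j → f j < g j → sum f < sum g
sum-mono-< f≤g zero    fj<gj = +-mono-<-≤ fj<gj (sum-mono (f≤g ∘ suc))
sum-mono-< f≤g (suc j) fj<gj = +-mono-≤-< (f≤g zero) (sum-mono-< (f≤g ∘ suc) j fj<gj)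

sum-const : ∀ n c → sum {n} (λ _ → c) ≡ n * c
sum-const zero    c = refl
sum-const (suc n) c = cong (c +_) (sum-const n c)

-- If `f i ≤ g i` held for all `i`, the strict inequality at `j` would separate the sums. This
-- averaging later picks vertices of Y carrying more flow than they have cut arcs.
sum-≡⇒∃< : ∀ {n} {f g : Fin n → ℕ} → sum f ≡ sum g → ∀ j → f j < g j → ∃ λ i → g i < f i
sum-≡⇒∃< {f = f} {g} Σf≡Σg j fj<gj with any? (λ i → g i <? f i)
... | yes found = found
... | no  none  =
  contradiction Σf≡Σg (<⇒≢ (sum-mono-< (λ i → ≮⇒≥ λ gi<fi → none (i , gi<fi)) j fj<gj))

sum-pos : ∀ {n} (f : Fin n → Bool) {i} → f i ≡ true → 1 ≤ sum (λ j → ⟦ f j ⟧)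
sum-pos f {zero}  fi rewrite fi = s≤s z≤n
sum-pos f {suc i} fi = m≤n⇒m≤o+n ⟦ f zero ⟧ (sum-pos (f ∘ suc) fi)

sum-pos⁻¹ : ∀ {n} (f : Fin n → Bool) → 1 ≤ sum (λ j → ⟦ f j ⟧) → ∃ λ i → f i ≡ true
sum-pos⁻¹ {suc n} f p with f zero in eq
... | true  = zero , eq
... | false with i , fi ← sum-pos⁻¹ (f ∘ suc) p = suc i , fi

listSum≡sum : ∀ {n} (f : Fin n → ℕ) → ListAction.sum (map f (allFin n)) ≡ sum f
listSum≡sum f = trans (cong ListAction.sum (map-tabulate id f)) (go f)
  where
  go : ∀ {n} (f : Fin n → ℕ) → ListAction.sum (tabulate f) ≡ sum f
  go {zero}  f = refl
  go {suc n} f = cong (f zero +_) (go (f ∘ suc))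

-- Simple paths and the set reachable from a point.

data SimplePath {A : Set} (R : Rel A 0ℓ) (t : A) : A → List A → Set where
  stop : SimplePath R t t [ t ]
  step : ∀ {x y xs} → R x y → x ∉ xs → SimplePath R t y xs → SimplePath R t x (x ∷ xs)

module _ {A : Set} {R : Rel A 0ℓ} where

  suffix : ∀ {t x y xs} → SimplePath R t y xs → x ∈ xs → ∃ (SimplePath R t x)
  suffix stop             (here refl) = _ , stop
  suffix p@(step _ _ _)   (here refl) = _ , p
  suffix (step _ _ p)     (there x∈)  = suffix p x∈

  -- Loop erasure: if `x` recurs on the simplified tail, the suffix starting there is taken instead.
  simplify : DecidableEquality A → ∀ {x t} → Star R x t → ∃ (SimplePath R t x)
  simplify _≟_ ε = _ , stop
  simplify _≟_ (_◅_ {x} r rs) with simplify _≟_ rs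
  ... | xs , p with anyElem? (x ≟_) xs
  ...   | yes x∈xs = suffix p x∈xs
  ...   | no  x∉xs = _ , step r x∉xs p

  -- Pushing flow out of a node `v` may destroy residual arcs leaving `v`, but no others. The rest
  -- of a simple path never returns to `v`, so it survives.
  relocate : ∀ {R′ : Rel A 0ℓ} {v t x xs} → (∀ {a b} → a ≢ v → R a b → R′ a b) →
             v ∉ xs → SimplePath R t x xs → SimplePath R′ t x xs
  relocate R⇒R′ v∉ stop = stop
  relocate R⇒R′ v∉ (step r x∉ p) =
    step (R⇒R′ (λ x≡v → v∉ (here (sym x≡v))) r) x∉ (relocate R⇒R′ (λ v∈ → v∉ (there v∈)) p)

  -- Exhaustive search: `us` contains every element not yet in `vs`, and its length, bounded by `k`,
  -- drops with each element moved to `vs`.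
  closure : Decidable R → (univ : List A) → (∀ a → a ∈ univ) → ∀ s →
            ∃ λ vs → s ∈ vs × (∀ {a} → a ∈ vs → Star R s a) × (∀ {a b} → a ∈ vs → R a b → b ∈ vs)
  closure R? univ complete s =
    go (length univ) univ ≤-refl [ s ] (here refl) (λ { (here refl) → ε }) (λ a → inj₂ (complete a))
    where
    go : ∀ k us → length us ≤ k → ∀ vs → s ∈ vs → (∀ {a} → a ∈ vs → Star R s a) →
         (∀ a → a ∈ vs ⊎ a ∈ us) →
         ∃ λ vs → s ∈ vs × (∀ {a} → a ∈ vs → Star R s a) × (∀ {a b} → a ∈ vs → R a b → b ∈ vs)
    go k us len vs s∈ reach split with anyElem? (λ u → anyElem? (λ v → R? v u) vs) us
    ... | no none = vs , s∈ , reach , closed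
      where
      closed : ∀ {a b} → a ∈ vs → R a b → b ∈ vs
      closed {b = b} a∈ r with split b
      ... | inj₁ b∈ = b∈
      ... | inj₂ b∈ = contradiction (lose b∈ (lose a∈ r)) none
    ... | yes some with find some
    ... | u , u∈ , some′ with find some′
    ... | v , v∈ , r with ∈-∃++ u∈
    ... | ps , qs , refl = next k len
      where
      split′ : ∀ a → a ∈ u ∷ vs ⊎ a ∈ ps ++ qs
      split′ a with split a
      ... | inj₁ a∈ = inj₁ (there a∈)
      ... | inj₂ a∈ with ∈-++⁻ ps a∈
      ...   | inj₁ a∈ps         = inj₂ (∈-++⁺ˡ a∈ps)
      ...   | inj₂ (here refl)  = inj₁ (here refl)
      ...   | inj₂ (there a∈qs) = inj₂ (∈-++⁺ʳ ps a∈qs)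

      reach′ : ∀ {a} → a ∈ u ∷ vs → Star R s a
      reach′ (here refl) = reach v∈ ◅◅ (r ◅ ε)
      reach′ (there a∈)  = reach a∈

      len-drop : length (ps ++ [ u ] ++ qs) ≡ suc (length (ps ++ qs))
      len-drop rewrite length-++ ps {[ u ] ++ qs} | length-++ ps {qs} = +-suc (length ps) (length qs)

      next : ∀ k → length (ps ++ [ u ] ++ qs) ≤ k → _
      next zero    le rewrite len-drop with () ← le
      next (suc k) le rewrite len-drop with s≤s le′ ← le =
        go k (ps ++ qs) le′ (u ∷ vs) (there s∈) reach′ split′

-- Sets of arcs, their degrees, and the nodes of the residual network.

ArcSet : ℕ → Set
ArcSet n = Fin n → Fin n → Bool

module _ {n : ℕ} where

  out inn : ArcSet n → Fin n → ℕ
  out f x = sum (λ z → ⟦ f x z ⟧)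
  inn f z = sum (λ x → ⟦ f x z ⟧)

  set : ArcSet n → Fin n → Fin n → Bool → ArcSet n
  set f x z b p q = if does (p ≟F x) ∧ does (q ≟F z) then b else f p q

  infix 4 _≐_+arc_,_
  -- An equation between indicators, so that summing a row or a column updates degrees by plain
  -- arithmetic. With the two sets exchanged it describes deletion of an arc.
  _≐_+arc_,_ : ArcSet n → ArcSet n → Fin n → Fin n → Set
  f′ ≐ f +arc x , z = ∀ p q → ⟦ f′ p q ⟧ ≡ ⟦ f p q ⟧ + δ p x * δ q z

  set-true : ∀ f {x z} → f x z ≡ false → set f x z true ≐ f +arc x , z
  set-true f {x} {z} fxz p q with p ≟F x | q ≟F z
  ... | yes refl | yes refl rewrite fxz = refl
  ... | yes _    | no _  = sym (+-identityʳ _)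
  ... | no _     | _     = sym (+-identityʳ _)

  set-false : ∀ f {x z} → f x z ≡ true → f ≐ set f x z false +arc x , z
  set-false f {x} {z} fxz p q with p ≟F x | q ≟F z
  ... | yes refl | yes refl rewrite fxz = refl
  ... | yes _    | no _  = sym (+-identityʳ _)
  ... | no _     | _     = sym (+-identityʳ _)

  set-here : ∀ f x z b → set f x z b x z ≡ b
  set-here f x z b with x ≟F x | z ≟F z
  ... | yes _ | yes _ = refl
  ... | yes _ | no ¬p = contradiction refl ¬p
  ... | no ¬p | _     = contradiction refl ¬p

  set-preserves : ∀ f x z b {p q} {c} → f p q ≡ c → b ≡ c → set f x z b p q ≡ c
  set-preserves f x z b {p} {q} fpq b≡c with p ≟F x | q ≟F z
  ... | yes _ | yes _ = b≡c
  ... | yes _ | no _  = fpq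
  ... | no _  | _     = fpq

  set-false⇒ : ∀ f x z {p q} → set f x z false p q ≡ true → f p q ≡ true
  set-false⇒ f x z {p} {q} e with p ≟F x | q ≟F z
  ... | yes _ | no _  = e
  ... | no _  | _     = e

  set-other : ∀ f {x z} b {p q} → ¬ (p ≡ x × q ≡ z) → set f x z b p q ≡ f p q
  set-other f {x} {z} b {p} {q} ne with p ≟F x | q ≟F z
  ... | yes p≡x | yes q≡z = contradiction (p≡x , q≡z) ne
  ... | yes _   | no _    = refl
  ... | no _    | _       = refl

  out-+arc : ∀ {f f′ x z} → f′ ≐ f +arc x , z → ∀ p → out f′ p ≡ out f p + δ p x
  out-+arc {f} {f′} {x} {z} eq p = begin
    out f′ p                                        ≡⟨ sum-cong-≗ (eq p) ⟩
    sum (λ q → ⟦ f p q ⟧ + δ p x * δ q z)           ≡⟨ ∑-distrib-+ (λ q → ⟦ f p q ⟧) _ ⟩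
    out f p + sum (λ q → δ p x * δ q z)             ≡⟨ cong (out f p +_) (sym (*-distribˡ-sum (δ p x) (λ q → δ q z))) ⟩
    out f p + δ p x * sum (λ q → δ q z)             ≡⟨ cong (λ k → out f p + δ p x * k) (sum-δ z) ⟩
    out f p + δ p x * 1                             ≡⟨ cong (out f p +_) (*-identityʳ _) ⟩
    out f p + δ p x                                 ∎
    where open ≡-Reasoning

  inn-+arc : ∀ {f f′ x z} → f′ ≐ f +arc x , z → ∀ q → inn f′ q ≡ inn f q + δ q z
  inn-+arc {f} {f′} {x} {z} eq q =
    out-+arc {λ a b → f b a} {λ a b → f′ b a} {z} {x}
      (λ p r → trans (eq r p) (cong (⟦ f r p ⟧ +_) (*-comm (δ r x) (δ p z)))) q

  sum-out : ∀ f {x z} → f x z ≡ true → sum (out f) ≡ suc (sum (out (set f x z false)))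
  sum-out f {x} {z} fxz = begin
    sum (out f)                          ≡⟨ sum-cong-≗ (out-+arc (set-false f fxz)) ⟩
    sum (λ p → out f′ p + δ p x)         ≡⟨ ∑-distrib-+ (out f′) (λ p → δ p x) ⟩
    sum (out f′) + sum (λ p → δ p x)     ≡⟨ cong (sum (out f′) +_) (sum-δ x) ⟩
    sum (out f′) + 1                     ≡⟨ +-comm (sum (out f′)) 1 ⟩
    suc (sum (out f′))                   ∎
    where
    open ≡-Reasoning
    f′ = set f x z false

  data Node : Set where
    ι ο : Fin n → Node

  _≟N_ : DecidableEquality Node
  ι x ≟N ι y = map′ (cong ι) (λ { refl → refl }) (x ≟F y)
  ι x ≟N ο y = no λ ()
  ο x ≟N ι y = no λ ()
  ο x ≟N ο y = map′ (cong ο) (λ { refl → refl }) (x ≟F y)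

  nodes : List Node
  nodes = map ι (allFin n) ++ map ο (allFin n)

  ∈-nodes : ∀ ν → ν ∈ nodes
  ∈-nodes (ι x) = ∈-++⁺ˡ (∈-map⁺ ι (∈-allFin x))
  ∈-nodes (ο x) = ∈-++⁺ʳ (map ι (allFin n)) (∈-map⁺ ο (∈-allFin x))

  atι atο : Node → Fin n → ℕ
  atι (ι v) z = δ z v
  atι (ο v) z = 0
  atο (ι v) z = 0
  atο (ο v) z = δ z v

-- Flows in the residual network and augmentation.

module _ {n : ℕ} (D : Digraph n) where

  _⊆A : ArcSet n → Set
  f ⊆A = ∀ {x z} → f x z ≡ true → Arc D x z

  -- Every vertex x is split into ι x → ο x carrying flow g x, which has no upper bound but must
  -- stay positive once it is: hence 2 ≤ g z in rev.
  data Res (f : ArcSet n) (g : Fin n → ℕ) : Node {n} → Node {n} → Set where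
    fwd : ∀ {x z} → Arc D x z → f x z ≡ false → Res f g (ο x) (ι z)
    bwd : ∀ {x z} → f x z ≡ true → Res f g (ι z) (ο x)
    thr : ∀ {z} → Res f g (ι z) (ο z)
    rev : ∀ {z} → 2 ≤ g z → Res f g (ο z) (ι z)

  Res? : ∀ f g → Decidable (Res f g)
  Res? f g (ι z) (ι _) = no λ ()
  Res? f g (ο z) (ο _) = no λ ()
  Res? f g (ι z) (ο x) =
    map′ (λ { (inj₁ e) → bwd e ; (inj₂ refl) → thr }) (λ { (bwd e) → inj₁ e ; thr → inj₂ refl })
         ((f x z ≟B true) ⊎-dec (x ≟F z))
  Res? f g (ο x) (ι z) =
    map′ (λ { (inj₁ (a , e)) → fwd a e ; (inj₂ (refl , p)) → rev p })
         (λ { (fwd a e) → inj₁ (a , e) ; (rev p) → inj₂ (refl , p) })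
         (((Digraph.arc D x z ≟B true) ×-dec (f x z ≟B false)) ⊎-dec ((x ≟F z) ×-dec (2 ≤? g x)))

  -- Conservation with a unit of flow missing at ι y and a surplus unit at ν.
  record Flow (y : Fin n) (ν : Node {n}) (f : ArcSet n) (g : Fin n → ℕ) : Set where
    field
      sub  : f ⊆A
      consι : ∀ z → inn f z + δ z y ≡ g z + atι ν z
      consο : ∀ z → g z ≡ out f z + atο ν z

  module _ {y : Fin n} where
    open Flow

    -- The surplus unit moves from `ν` to `ν′`. Only residual arcs leaving `ν` can disappear, which
    -- a simple path tolerates, and positive throughput stays positive, so no covered vertex is
    -- lost.
    push : ∀ {ν ν′ f g} → Flow y ν f g → Res f g ν ν′ →
           ∃₂ λ f′ g′ → Flow y ν′ f′ g′
                      × (∀ {a b} → a ≢ ν → Res f g a b → Res f′ g′ a b)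
                      × (∀ z → 1 ≤ g z → 1 ≤ g′ z)
    push {f = f} {g} F (fwd {x} {z} a fxz) = f′ , g , F′ , keep , λ _ p → p
      where
      f′ = set f x z true
      keep : ∀ {a b} → a ≢ ο x → Res f g a b → Res f′ g a b
      keep ne (fwd a e) = fwd a (trans (set-other f true λ { (refl , _) → ne refl }) e)
      keep ne (bwd e) = bwd (set-preserves f x z true e refl)
      keep ne thr     = thr
      keep ne (rev p) = rev p
      sub′ : f′ ⊆A
      sub′ {p} {q} e with p ≟F x | q ≟F z
      ... | yes refl | yes refl = a
      ... | yes _    | no _     = sub F e
      ... | no _     | _        = sub F e
      F′ : Flow y (ι z) f′ g
      F′ .sub = sub′
      F′ .consι q = begin
        inn f′ q + δ q y          ≡⟨ cong (_+ δ q y) (inn-+arc (set-true f fxz) q) ⟩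
        inn f q + δ q z + δ q y   ≡⟨ +-assoc (inn f q) _ _ ⟩
        inn f q + (δ q z + δ q y) ≡⟨ cong (inn f q +_) (+-comm (δ q z) _) ⟩
        inn f q + (δ q y + δ q z) ≡⟨ +-assoc (inn f q) _ _ ⟨
        inn f q + δ q y + δ q z   ≡⟨ cong (_+ δ q z) (trans (consι F q) (+-identityʳ _)) ⟩
        g q + δ q z               ∎
        where open ≡-Reasoning
      F′ .consο p = trans (consο F p) (sym (trans (+-identityʳ _) (out-+arc (set-true f fxz) p)))
    push {f = f} {g} F (bwd {x} {z} fxz) = f′ , g , F′ , keep , λ _ p → p
      where
      f′ = set f x z false
      keep : ∀ {a b} → a ≢ ι z → Res f g a b → Res f′ g a b
      keep ne (fwd a e) = fwd a (set-preserves f x z false e refl)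
      keep ne (bwd e) = bwd (trans (set-other f false λ { (_ , refl) → ne refl }) e)
      keep ne thr     = thr
      keep ne (rev p) = rev p
      F′ : Flow y (ο x) f′ g
      F′ .sub e = sub F (set-false⇒ f x z e)
      F′ .consι q = +-cancelʳ-≡ (δ q z) _ _ (begin
        inn f′ q + δ q y + δ q z   ≡⟨ +-assoc (inn f′ q) _ _ ⟩
        inn f′ q + (δ q y + δ q z) ≡⟨ cong (inn f′ q +_) (+-comm (δ q y) _) ⟩
        inn f′ q + (δ q z + δ q y) ≡⟨ +-assoc (inn f′ q) _ _ ⟨
        inn f′ q + δ q z + δ q y   ≡⟨ cong (_+ δ q y) (inn-+arc (set-false f fxz) q) ⟨
        inn f q + δ q y            ≡⟨ consι F q ⟩
        g q + δ q z                ≡⟨ cong (_+ δ q z) (+-identityʳ (g q)) ⟨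
        g q + 0 + δ q z            ∎)
        where open ≡-Reasoning
      F′ .consο p = trans (consο F p) (trans (+-identityʳ _) (out-+arc (set-false f fxz) p))
    push {f = f} {g} F (thr {z}) = f , g′ , F′ , keep , λ v p → ≤-trans p (m≤m+n _ _)
      where
      g′ : Fin n → ℕ
      g′ v = g v + δ v z
      keep : ∀ {a b} → a ≢ ι z → Res f g a b → Res f g′ a b
      keep ne (fwd a e) = fwd a e
      keep ne (bwd e) = bwd e
      keep ne thr     = thr
      keep ne (rev p) = rev (≤-trans p (m≤m+n _ _))
      F′ : Flow y (ο z) f g′
      F′ .sub = sub F
      F′ .consι q = trans (consι F q) (sym (+-identityʳ _))
      F′ .consο p = cong (_+ δ p z) (trans (consο F p) (+-identityʳ _))
    push {f = f} {g} F (rev {z} 2≤gz) = f , g′ , F′ , keep , pos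
      where
      g′ : Fin n → ℕ
      g′ v = g v ∸ δ v z
      g′+δ : ∀ v → g′ v + δ v z ≡ g v
      g′+δ v = m∸n+n≡m δ≤g
        where
        δ≤g : δ v z ≤ g v
        δ≤g with v ≟F z
        ... | yes refl = ≤-trans (s≤s z≤n) 2≤gz
        ... | no _     = z≤n
      g′-≢ : ∀ {v} → v ≢ z → g′ v ≡ g v
      g′-≢ {v} v≢z = cong (g v ∸_) (δ-≢ v≢z)
      keep : ∀ {a b} → a ≢ ο z → Res f g a b → Res f g′ a b
      keep ne (fwd a e) = fwd a e
      keep ne (bwd e) = bwd e
      keep ne thr     = thr
      keep ne (rev p) = rev (subst (2 ≤_) (sym (g′-≢ λ { refl → ne refl })) p)
      pos : ∀ v → 1 ≤ g v → 1 ≤ g′ v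
      pos v p with v ≟F z
      ... | yes refl = ∸-monoˡ-≤ 1 2≤gz
      ... | no _     = p
      F′ : Flow y (ι z) f g′
      F′ .sub = sub F
      F′ .consι q = trans (consι F q) (trans (+-identityʳ _) (sym (g′+δ q)))
      F′ .consο p = +-cancelʳ-≡ (δ p z) _ _
        (trans (g′+δ p) (trans (consο F p) (cong (_+ δ p z) (sym (+-identityʳ _)))))

    pushAlong : ∀ {ν t f g} xs → SimplePath (Res f g) t ν xs → Flow y ν f g →
                ∃₂ λ f′ g′ → Flow y t f′ g′ × (∀ z → 1 ≤ g z → 1 ≤ g′ z)
    pushAlong _        stop          F = _ , _ , F , λ _ p → p
    pushAlong (_ ∷ xs) (step r ν∉ p) F =
      let f′ , g′ , F′ , keep , pos  = push F r
          f″ , g″ , F″ , pos′        = pushAlong xs (relocate keep ν∉ p) F′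
      in f″ , g″ , F″ , λ z q → pos′ z (pos z q)

  record Balanced (f : ArcSet n) : Set where
    field
      sub : f ⊆A
      bal : ∀ z → inn f z ≡ out f z

  open Balanced

  -- Raising the throughput of `y` by one without changing any arc leaves a deficit at `ι y` and a
  -- surplus at `ο y`. Carrying the surplus along the path cancels both, and the throughput stays
  -- positive at `y` and at every covered vertex.
  augment : ∀ {f y} → Balanced f → Star (Res f (λ z → out f z + δ z y)) (ο y) (ι y) →
            ∃ λ f′ → Balanced f′ × 1 ≤ out f′ y × (∀ z → 1 ≤ out f z → 1 ≤ out f′ z)
  augment {f} {y} B path with xs , p ← simplify _≟N_ path
    with f′ , g′ , F′ , pos ← pushAlong xs p
           (record { sub = sub B ; consι = λ z → trans (cong (_+ δ z y) (bal B z)) (sym (+-identityʳ _))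
                   ; consο = λ _ → refl })
    = f′ , record { sub = Flow.sub F′ ; bal = bal′ }
    , out≥1 y (pos y (subst (λ k → 1 ≤ out f y + k) (sym (δ-refl y)) (m≤n+m 1 _)))
    , λ z q → out≥1 z (pos z (≤-trans q (m≤m+n _ _)))
    where
    g≡out : ∀ z → g′ z ≡ out f′ z
    g≡out z = trans (Flow.consο F′ z) (+-identityʳ _)
    bal′ : ∀ z → inn f′ z ≡ out f′ z
    bal′ z = trans (+-cancelʳ-≡ (δ z y) _ _ (Flow.consι F′ z)) (g≡out z)
    out≥1 : ∀ z → 1 ≤ g′ z → 1 ≤ out f′ z
    out≥1 z = subst (1 ≤_) (g≡out z)

-- Boolean facts and degree counting in multipartite digraphs.

true≢false : ∀ {b} → b ≡ true → b ≢ false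
true≢false refl ()

≢true⇒false : ∀ {b} → b ≢ true → b ≡ false
≢true⇒false {false} _ = refl
≢true⇒false {true}  h = contradiction refl h

⟦⟧≡0 : ∀ {b} → b ≢ true → ⟦ b ⟧ ≡ 0
⟦⟧≡0 h = cong ⟦_⟧ (≢true⇒false h)

⟦⟧≤1 : ∀ b → ⟦ b ⟧ ≤ 1
⟦⟧≤1 false = z≤n
⟦⟧≤1 true  = ≤-refl

⟦⟧-excl : ∀ {a b} → ¬ (a ≡ true × b ≡ true) → ⟦ a ⟧ + ⟦ b ⟧ ≤ 1
⟦⟧-excl {false} {b}     _ = ⟦⟧≤1 b
⟦⟧-excl {true}  {false} _ = ≤-refl
⟦⟧-excl {true}  {true}  h = contradiction (refl , refl) h

module _ {n : ℕ} (D : Digraph n) where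
  open Digraph D

  leaving : ∀ (P : Fin n → Bool) {p q} → Reach D p q → P p ≡ true → P q ≡ false →
            ∃₂ λ a b → Arc D a b × P a ≡ true × P b ≡ false
  leaving P here Pp Pq = contradiction Pq (true≢false Pp)
  leaving P (step {y = y} a r) Pp Pq with P y in eq
  ... | true  = leaving P r eq Pq
  ... | false = _ , _ , a , Pp , eq

module Multipartite {n : ℕ} (D : Digraph n) (smp : SemicompleteMultipartite D) where
  open Digraph D

  part : Fin n → ℕ
  part = proj₁ smp

  arc⇒≢part : ∀ {x z} → Arc D x z → part x ≢ part z
  arc⇒≢part {x} {z} a eq with x ≟F z
  ... | yes refl = true≢false a (loopless x)
  ... | no x≢z   = true≢false a (proj₁ (proj₁ (proj₂ smp) x z x≢z eq))

  ≡part⇒nonadjacent : ∀ {x z} → x ≢ z → part x ≡ part z → Nonadjacent D x z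
  ≡part⇒nonadjacent x≢z eq = x≢z , proj₁ (proj₂ smp) _ _ x≢z eq

  adjacent : ∀ {x z} → part x ≢ part z → Arc D x z ⊎ Arc D z x
  adjacent = proj₂ (proj₂ smp) _ _

  deg-sum : ∀ x → deg D x ≡ sum (λ z → ⟦ arc z x ⟧ + ⟦ arc x z ⟧)
  deg-sum x = trans
    (cong₂ _+_ (listSum≡sum (λ z → ⟦ arc z x ⟧)) (listSum≡sum (λ z → ⟦ arc x z ⟧)))
    (sym (∑-distrib-+ (λ z → ⟦ arc z x ⟧) (λ z → ⟦ arc x z ⟧)))

  -- A vertex in the common part of `y` and `u` is joined to neither, so each one counted by `l`
  -- falls short by two of an average of two per vertex. Every other vertex contributes at most
  -- `2 + h z`.
  deg-bound : ∀ {y u} (l h : Fin n → ℕ) → part u ≡ part y →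
    (∀ z → part z ≡ part y → l z ≤ 1) → (∀ z → part z ≢ part y → l z ≡ 0) →
    (∀ z → ⟦ arc z y ⟧ + ⟦ arc y z ⟧ ≤ 1) →
    (∀ z → ⟦ arc z u ⟧ + ⟦ arc u z ⟧ ≤ 1 + h z) →
    2 * n ≤ deg D y + deg D u + 3 → 2 * sum l ≤ sum h + 3
  deg-bound {y} {u} l h u~y l≤1 l≡0 y-bound u-bound degs =
    +-cancelˡ-≤ (2 * n) _ _ (begin
      2 * n + 2 * sum l                    ≤⟨ +-monoˡ-≤ (2 * sum l) degs ⟩
      deg D y + deg D u + 3 + 2 * sum l    ≡⟨ solve 2 (λ a b → a :+ con 3 :+ b := (a :+ b) :+ con 3) refl (deg D y + deg D u) (2 * sum l) ⟩
      (deg D y + deg D u + 2 * sum l) + 3  ≡⟨ cong (_+ 3) total ⟩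
      sum (λ z → dy z + du z + 2 * l z) + 3 ≤⟨ +-monoˡ-≤ 3 (sum-mono pointwise) ⟩
      sum (λ z → 2 + h z) + 3              ≡⟨ cong (_+ 3) (trans (∑-distrib-+ (λ _ → 2) h) (cong (_+ sum h) (trans (sum-const n 2) (*-comm n 2)))) ⟩
      2 * n + sum h + 3                    ≡⟨ +-assoc (2 * n) (sum h) 3 ⟩
      2 * n + (sum h + 3)                  ∎)
    where
    open ≤-Reasoning
    open +-*-Solver using (solve; con; _:+_; _:=_)
    dy du : Fin n → ℕ
    dy z = ⟦ arc z y ⟧ + ⟦ arc y z ⟧
    du z = ⟦ arc z u ⟧ + ⟦ arc u z ⟧
    total : deg D y + deg D u + 2 * sum l ≡ sum (λ z → dy z + du z + 2 * l z)
    total = trans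
      (cong₂ _+_ (trans (cong₂ _+_ (deg-sum y) (deg-sum u)) (sym (∑-distrib-+ dy du))) (*-distribˡ-sum 2 l))
      (sym (∑-distrib-+ (λ z → dy z + du z) (λ z → 2 * l z)))
    no-arcs : ∀ {v} z → part z ≡ part v → ⟦ arc z v ⟧ + ⟦ arc v z ⟧ ≡ 0
    no-arcs z eq = cong₂ _+_ (⟦⟧≡0 λ a → arc⇒≢part a eq) (⟦⟧≡0 λ a → arc⇒≢part a (sym eq))
    pointwise : ∀ z → dy z + du z + 2 * l z ≤ 2 + h z
    pointwise z with part z ≟ℕ part y
    ... | yes eq rewrite no-arcs z eq | no-arcs z (trans eq (sym u~y)) =
      ≤-trans (*-monoʳ-≤ 2 (l≤1 z eq)) (m≤m+n 2 (h z))
    ... | no ne rewrite l≡0 z ne | +-identityʳ (dy z + du z) = +-mono-≤ (y-bound z) (u-bound z)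

-- The cut obtained when no residual path exists.

-- A set of residual nodes closed under residual arcs, given by s x = [ο x ∈ S] and t x = [ι x ∈ S].
record Blocked {n : ℕ} (D : Digraph n) (f : ArcSet n) (y : Fin n) (s t : Fin n → Bool) : Set where
  field
    thr-closed : ∀ {x} → t x ≡ true → s x ≡ true
    fwd-closed : ∀ {x z} → s x ≡ true → t z ≡ false → Arc D x z → f x z ≡ true
    bwd-closed : ∀ {x z} → t z ≡ true → f x z ≡ true → s x ≡ true
    rev-closed : ∀ {z} → s z ≡ true → t z ≡ false → out f z ≤ 1
    sy  : s y ≡ true
    ty  : t y ≡ false

module Cut {n : ℕ} {D : Digraph n} {f : ArcSet n} (B : Balanced D f)
           {y : Fin n} {s t : Fin n → Bool} (blocked : Blocked D f y s t) where
  open Blocked blocked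
  open Balanced B

  -- R₁ is where `s` fails, R₂ where `t` holds, and Y is the rest. By `fwd-closed` these are all
  -- arcs of `D` from Y ∪ R₂ to Y ∪ R₁.
  cut : ArcSet n
  cut x z = (s x ∧ not (t z)) ∧ f x z

  through : Fin n → ℕ
  through x = if s x ∧ not (t x) then out f x else 0

  cut-true : ∀ {x z} → s x ≡ true → t z ≡ false → Arc D x z → cut x z ≡ true
  cut-true sx tz a rewrite sx | tz = fwd-closed sx tz a

  -- The arcs of `f` leaving Y ∪ R₂ are counted twice. By tails they amount to the inflow of R₂, by
  -- balance, plus the flow through Y. By heads they are the arcs of `f` into R₂, all of which start
  -- in Y ∪ R₂ by `bwd-closed`, plus the cut arcs.
  sum-through≡sum-out-cut : sum through ≡ sum (out cut)
  sum-through≡sum-out-cut = +-cancelˡ-≡ (sum innT) _ _ (begin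
    sum innT + sum through               ≡⟨ ∑-distrib-+ innT through ⟨
    sum (λ x → innT x + through x)       ≡⟨ sum-cong-≗ split-vertex ⟨
    sum outS                             ≡⟨ sum-cong-≗ (λ x → sum-cong-≗ (split-arc x)) ⟩
    sum (λ x → sum (λ z → ⟦ t z ∧ f x z ⟧ + ⟦ cut x z ⟧))
                                         ≡⟨ sum-cong-≗ (λ x → ∑-distrib-+ (λ z → ⟦ t z ∧ f x z ⟧) (λ z → ⟦ cut x z ⟧)) ⟩
    sum (λ x → sum (λ z → ⟦ t z ∧ f x z ⟧) + out cut x)
                                         ≡⟨ ∑-distrib-+ (λ x → sum (λ z → ⟦ t z ∧ f x z ⟧)) (out cut) ⟩
    sum (λ x → sum (λ z → ⟦ t z ∧ f x z ⟧)) + sum (out cut)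
                                         ≡⟨ cong (_+ sum (out cut)) (∑-comm (λ x z → ⟦ t z ∧ f x z ⟧)) ⟩
    sum innT + sum (out cut)             ∎)
    where
    open ≡-Reasoning
    outS innT : Fin n → ℕ
    outS x = sum (λ z → ⟦ s x ∧ f x z ⟧)
    innT z = sum (λ x → ⟦ t z ∧ f x z ⟧)
    split-arc : ∀ x z → ⟦ s x ∧ f x z ⟧ ≡ ⟦ t z ∧ f x z ⟧ + ⟦ cut x z ⟧
    split-arc x z with s x in sx | t z in tz | f x z in fxz
    ... | true  | true  | true  = refl
    ... | true  | true  | false = refl
    ... | true  | false | true  = refl
    ... | true  | false | false = refl
    ... | false | false | _     = refl
    ... | false | true  | false = refl
    ... | false | true  | true  = contradiction sx (true≢false (bwd-closed tz fxz))
    split-vertex : ∀ x → outS x ≡ innT x + through x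
    split-vertex x with s x in sx | t x in tx
    ... | true  | true  = trans (sym (bal x)) (sym (+-identityʳ _))
    ... | true  | false = sym (cong (_+ out f x) (sum-replicate-zero n))
    ... | false | false = sym (trans (+-identityʳ _) refl)
    ... | false | true  = contradiction sx (true≢false (thr-closed tx))

  sum-through≡sum-inn-cut : sum through ≡ sum (inn cut)
  sum-through≡sum-inn-cut = trans sum-through≡sum-out-cut (∑-comm (λ x z → ⟦ cut x z ⟧))

  -- `rev-closed` caps the flow through a vertex of Y at one, so flow exceeding `k` is exactly one
  -- and `k` is zero.
  through-vertex : ∀ {u} {k} → k < through u →
                   s u ≡ true × t u ≡ false × out f u ≡ 1 × k ≡ 0
  through-vertex {u} k<th with s u in su | t u in tu
  ... | true | false = refl , refl , ≤-antisym (rev-closed su tu) (≤-trans (s≤s z≤n) k<th)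
                     , n<1⇒n≡0 (<-≤-trans k<th (rev-closed su tu))

  through-zero : ∀ {x} → t x ≡ true ⊎ s x ≡ false → through x ≡ 0
  through-zero {x} h with s x | t x | h
  ... | true  | true  | _       = refl
  ... | false | _     | _       = refl
  ... | true  | false | inj₁ ()
  ... | true  | false | inj₂ ()

-- Existence of an eulerian factor.

module Factor {n : ℕ} (D : Digraph n) (strong : Strong D) (smp : SemicompleteMultipartite D)
  (deg-cond : ∀ (u v : Fin n) → Nonadjacent D u v → Dominated D u v → 2 * n ≤ deg D u + deg D v + 3)
  where
  open Digraph D
  open Multipartite D smp
  open Balanced

  unblocked : ∀ {f y w s t} → Balanced D f → out f y ≡ 0 → Arc D w y → ¬ Blocked D f y s t
  unblocked {f} {y} {w} {s} {t} B out-y a-wy blocked = final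
    where
    open Blocked blocked
    open Cut B blocked

    f-from-y : ∀ {z} → f y z ≢ true
    f-from-y e = <⇒≢ (sum-pos (f y) e) (sym out-y)

    f-to-y : ∀ {x} → f x y ≢ true
    f-to-y {x} e = <⇒≢ (sum-pos (λ x → f x y) e) (sym (trans (bal B y) out-y))

    from-y : ∀ {z} → Arc D y z → t z ≡ true
    from-y {z} a with t z in tz
    ... | true  = refl
    ... | false = contradiction (fwd-closed sy tz a) f-from-y

    to-y : ∀ {x} → Arc D x y → s x ≡ false
    to-y {x} a with s x in sx
    ... | false = refl
    ... | true  = contradiction (fwd-closed sx ty a) f-to-y

    -- An arc from `u` to `y` would put `u` into R₁, an arc from `y` to `u` would put it into R₂. So
    -- a vertex of Y is not adjacent to `y`.
    same-part : ∀ {u} → s u ≡ true → t u ≡ false → part u ≡ part y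
    same-part {u} su tu with part u ≟ℕ part y
    ... | yes eq = eq
    ... | no ne with adjacent ne
    ...   | inj₁ a = contradiction (to-y a) (true≢false su)
    ...   | inj₂ a = contradiction tu (true≢false (from-y a))

    -- Some arc leaves the set formed by R₂ and `y`. Its tail is not `y`, whose out-neighbours lie
    -- in R₂, so it is a vertex of R₂: it has an outgoing cut arc but counts zero in `through`. As
    -- the totals agree, some other vertex has the opposite imbalance.
    tail-witness : ∃ λ u → out cut u < through u
    tail-witness with leaving D (λ x → t x ∨ does (x ≟F y)) (strong y w) start end
      where
      start : t y ∨ does (y ≟F y) ≡ true
      start rewrite ty = dec-true (y ≟F y) refl
      end : t w ∨ does (w ≟F y) ≡ false
      end with t w in tw
      ... | true  = contradiction (to-y a-wy) (true≢false (thr-closed tw))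
      ... | false = dec-false (w ≟F y) λ { refl → true≢false a-wy (loopless w) }
    ... | r , q , a , Pr , Pq with t r in tr | t q in tq | r ≟F y
    ...   | _     | false | yes refl = contradiction tq (true≢false (from-y a))
    ...   | true  | false | no _     = sum-≡⇒∃< sum-through≡sum-out-cut r
              (subst (_< out cut r) (sym (through-zero (inj₁ tr))) (sum-pos (cut r) (cut-true (thr-closed tr) tq a)))

    -- The dual argument: an arc from Y ∪ R₂ into R₁ enters a vertex that receives a cut arc and
    -- counts zero in `through`.
    head-witness : ∃ λ u → inn cut u < through u
    head-witness with leaving D s (strong y w) sy (to-y a-wy)
    ... | r , q , a , sr , sq = sum-≡⇒∃< sum-through≡sum-inn-cut q
              (subst (_< inn cut q) (sym (through-zero (inj₂ sq)))
                     (sum-pos (λ x → cut x q) (cut-true sr (≢true⇒false λ tq → true≢false (thr-closed tq) sq) a)))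

    y-bound : ∀ z → ⟦ arc z y ⟧ + ⟦ arc y z ⟧ ≤ 1
    y-bound z = ⟦⟧-excl λ (zy , yz) → true≢false (thr-closed (from-y yz)) (to-y zy)

    final : _
    final with tail-witness | head-witness
    ... | u , tail | u′ , head with through-vertex tail | through-vertex head
    ... | su , tu , out-u , tail0 | su′ , tu′ , out-u′ , head0 = conclude (u ≟F u′)
      where
      ≢y : ∀ {x} → out f x ≡ 1 → x ≢ y
      ≢y out-x refl with () ← trans (sym out-x) out-y
      u~y  = same-part su tu
      u′~y = same-part su′ tu′

      from-u : ∀ {z} → Arc D u z → t z ≡ true
      from-u {z} a with t z in tz
      ... | true  = refl
      ... | false = contradiction (sym tail0) (<⇒≢ (sum-pos (cut u) (cut-true su tz a)))

      to-u′ : ∀ {x} → Arc D x u′ → s x ≡ false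
      to-u′ {x} a with s x in sx
      ... | false = refl
      ... | true  = contradiction (sym head0) (<⇒≢ (sum-pos (λ x → cut x u′) (cut-true sx tu′ a)))

      -- `w` is outside the part of `u`, hence adjacent to `u`. An arc `(u , w)` would put `w` into
      -- R₂, but in-neighbours of `y` lie in R₁.
      dominated : Dominated D y u
      dominated with adjacent {w} {u} (λ eq → arc⇒≢part a-wy (trans eq u~y))
      ... | inj₁ a = w , a-wy , a
      ... | inj₂ a = contradiction (to-y a-wy) (true≢false (thr-closed (from-u a)))

      degs : 2 * n ≤ deg D y + deg D u + 3
      degs = deg-cond y u (≡part⇒nonadjacent (≢-sym (≢y out-u)) (sym u~y)) dominated

      outside : ∀ {z v} → part v ≡ part y → part z ≢ part y → δ z v ≡ 0
      outside {z} {v} eq ne = δ-≢ {x = z} {v} λ { refl → ne eq }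

      conclude : Dec (u ≡ u′) → _
      -- The part contains `y` and `u`, and neither vertex has a pair of opposite arcs, so the
      -- degree bound would read 2 * 2 ≤ 0 + 3.
      conclude (yes refl) = contradiction
        (subst (λ k → 2 * k ≤ _) l-total (deg-bound {y} {u} l (λ _ → 0) u~y l≤1 l≡0 y-bound u-bound degs))
        (subst (λ k → ¬ 4 ≤ k + 3) (sym (sum-replicate-zero n)) (<⇒≱ (s≤s ≤-refl)))
        where
        l : Fin n → ℕ
        l z = δ z y + δ z u
        l-total : sum l ≡ 2
        l-total = trans (∑-distrib-+ (λ z → δ z y) (λ z → δ z u)) (cong₂ _+_ (sum-δ y) (sum-δ u))
        l≤1 : ∀ z → part z ≡ part y → l z ≤ 1
        l≤1 z _ with z ≟F y | z ≟F u
        ... | yes refl | yes refl = contradiction refl (≢y out-u)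
        ... | yes _    | no _     = ≤-refl
        ... | no _     | yes _    = ≤-refl
        ... | no _     | no _     = z≤n
        l≡0 : ∀ z → part z ≢ part y → l z ≡ 0
        l≡0 z ne = cong₂ _+_ (outside refl ne) (outside u~y ne)
        u-bound : ∀ z → ⟦ arc z u ⟧ + ⟦ arc u z ⟧ ≤ 1 + 0
        u-bound z = ⟦⟧-excl λ (zu , uz) → true≢false (thr-closed (from-u uz)) (to-u′ zu)
      -- Now three vertices of the part are known, while opposite pairs at `u` are charged to the
      -- single arc of `f` entering `u`. The bound would read 2 * 3 ≤ 1 + 3.
      conclude (no u≢u′) = contradiction
        (≤-trans (subst (λ k → 2 * k ≤ _) l-total (deg-bound {y} {u} l (λ z → ⟦ f z u ⟧) u~y l≤1 l≡0 y-bound u-bound degs))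
                 (+-monoˡ-≤ 3 (≤-reflexive (trans (bal B u) out-u))))
        (<⇒≱ (s≤s (m≤n+m 4 1)))
        where
        l : Fin n → ℕ
        l z = δ z y + δ z u + δ z u′
        l-total : sum l ≡ 3
        l-total = trans (∑-distrib-+ (λ z → δ z y + δ z u) (λ z → δ z u′)) (cong₂ _+_
          (trans (∑-distrib-+ (λ z → δ z y) (λ z → δ z u)) (cong₂ _+_ (sum-δ y) (sum-δ u))) (sum-δ u′))
        l≤1 : ∀ z → part z ≡ part y → l z ≤ 1
        l≤1 z _ with z ≟F y | z ≟F u | z ≟F u′
        ... | yes refl | yes refl | _        = contradiction refl (≢y out-u)
        ... | yes refl | no _     | yes refl = contradiction refl (≢y out-u′)
        ... | yes _    | no _     | no _     = ≤-refl
        ... | no _     | yes refl | yes refl = contradiction refl u≢u′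
        ... | no _     | yes _    | no _     = ≤-refl
        ... | no _     | no _     | yes _    = ≤-refl
        ... | no _     | no _     | no _     = z≤n
        l≡0 : ∀ z → part z ≢ part y → l z ≡ 0
        l≡0 z ne = cong₂ _+_ (cong₂ _+_ (outside refl ne) (outside u~y ne)) (outside u′~y ne)
        u-bound : ∀ z → ⟦ arc z u ⟧ + ⟦ arc u z ⟧ ≤ 1 + ⟦ f z u ⟧
        u-bound z with arc z u in zu | arc u z in uz
        ... | false | false = z≤n
        ... | false | true  = s≤s z≤n
        ... | true  | false = s≤s z≤n
        -- Here `z` is an out-neighbour of `u`, hence in R₂, so the arc `(z , u)` belongs to the cut
        -- and is used by `f`.
        ... | true  | true  = s≤s (≤-reflexive (cong ⟦_⟧ (sym (fwd-closed (thr-closed (from-u uz)) tu zu))))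

  inNeighbour : ∀ y → ∀ {x} → x ≢ y → ∃ λ w → Arc D w y
  inNeighbour y {x} x≢y with leaving D (λ z → not (does (z ≟F y))) (strong x y)
           (cong not (dec-false (x ≟F y) x≢y)) (cong not (dec-true (y ≟F y) refl))
  ... | w , z , a , _ , Pz with z ≟F y
  ...   | yes refl = w , a

  -- The search from `ο y` either meets `ι y` and yields an augmenting path, or ends in a closed set
  -- excluded by `unblocked`.
  cover : ∀ {f y w} → Balanced D f → Arc D w y →
          ∃ λ f′ → Balanced D f′ × 1 ≤ out f′ y × (∀ z → 1 ≤ out f z → 1 ≤ out f′ z)
  cover {f} {y} {w} B a-wy with 1 ≤? out f y
  ... | yes covered = f , B , covered , λ _ p → p
  ... | no uncovered with closure (Res? D f (λ z → out f z + δ z y)) nodes ∈-nodes (ο y)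
  ... | vs , oy∈ , reach , closed with anyElem? (ι y ≟N_) vs
  ...   | yes iy∈ = augment D B (reach iy∈)
  ...   | no iy∉ = contradiction blocked (unblocked {s = s} {t = t} B out-y a-wy)
    where
    out-y : out f y ≡ 0
    out-y = n<1⇒n≡0 (≰⇒> uncovered)
    S? : ∀ ν → Dec (ν ∈ vs)
    S? ν = anyElem? (ν ≟N_) vs
    s t : Fin n → Bool
    s x = does (S? (ο x))
    t x = does (S? (ι x))
    ∈⇒ : ∀ {ν} → ν ∈ vs → does (S? ν) ≡ true
    ∈⇒ {ν} = dec-true (S? ν)
    ⇒∈ : ∀ {ν} → does (S? ν) ≡ true → ν ∈ vs
    ⇒∈ {ν} e with S? ν
    ... | yes p = p
    ⇒∉ : ∀ {ν} → does (S? ν) ≡ false → ν ∉ vs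
    ⇒∉ {ν} e ν∈ = true≢false (∈⇒ ν∈) e
    blocked : Blocked D f y s t
    blocked .Blocked.thr-closed tx = ∈⇒ (closed (⇒∈ tx) thr)
    blocked .Blocked.fwd-closed {x} {z} sx tz a with f x z in e
    ... | true  = refl
    ... | false = contradiction (closed (⇒∈ sx) (fwd a e)) (⇒∉ tz)
    blocked .Blocked.bwd-closed tz e = ∈⇒ (closed (⇒∈ tz) (bwd e))
    blocked .Blocked.rev-closed {z} sz tz with 2 ≤? out f z + δ z y
    ... | yes p = contradiction (closed (⇒∈ sz) (rev p)) (⇒∉ tz)
    ... | no ¬p = ≤-trans (m≤m+n _ (δ z y)) (≤-pred (≰⇒> ¬p))
    blocked .Blocked.sy = ∈⇒ oy∈
    blocked .Blocked.ty = dec-false (S? (ι y)) iy∉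

  eulerianFactor : (∀ y → ∃ λ w → Arc D w y) → ∃ λ f → Balanced D f × (∀ z → 1 ≤ out f z)
  eulerianFactor inNbr = let f , B , covered = go (allFin n) in f , B , λ z → covered (∈-allFin z)
    where
    go : ∀ ys → ∃ λ f → Balanced D f × (∀ {z} → z ∈ ys → 1 ≤ out f z)
    go [] = (λ _ _ → false) , record { sub = λ () ; bal = λ z → refl } , λ ()
    go (y ∷ ys) with f , B , covered ← go ys
      with f′ , B′ , covers-y , keeps ← cover B (proj₂ (inNbr y)) =
      f′ , B′ , λ { (here refl) → covers-y ; (there z∈) → keeps _ (covered z∈) }

-- Walks and the decomposition of a factor into closed trails.

Edge : ℕ → Set
Edge n = Fin n × Fin n

module _ {n : ℕ} where

  -- A visit is recorded at the head of an arc. On a closed trail every tail is also a head, so no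
  -- vertex is missed.
  Visits : List (Edge n) → Fin n → Set
  Visits es v = Any (λ e → v ≡ proj₂ e) es

  visits? : ∀ es v → Dec (Visits es v)
  visits? es v = anyElem? (λ e → v ≟F proj₂ e) es

  visit⇒arc : ∀ {es v} → Visits es v → ∃ λ p → (p , v) ∈ es
  visit⇒arc v∈ with (p , _) , e∈ , refl ← find v∈ = p , e∈

  head-visited : ∀ {es p v} → (p , v) ∈ es → Visits es v
  head-visited e∈ = lose e∈ refl

  _enumerates_ : List (Edge n) → ArcSet n → Set
  es enumerates f = Unique es × (∀ {p q} → f p q ≡ true → (p , q) ∈ es)
                              × (∀ {p q} → (p , q) ∈ es → f p q ≡ true)

  enumerates-∷ : ∀ {f x y es} → f x y ≡ true → es enumerates set f x y false →
                 ((x , y) ∷ es) enumerates f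
  enumerates-∷ {f} {x} {y} {es} fxy (uniq , all , only) = fresh ∷ uniq , all′ , only′
    where
    fresh : All ((x , y) ≢_) es
    fresh = All.tabulate λ { e∈ refl → true≢false (only e∈) (set-here f x y false) }
    all′ : ∀ {p q} → f p q ≡ true → (p , q) ∈ (x , y) ∷ es
    all′ {p} {q} e with p ≟F x | q ≟F y
    ... | yes refl | yes refl = here refl
    ... | yes _    | no q≢y   = there (all (trans (set-other f false λ { (_ , r) → q≢y r }) e))
    ... | no p≢x   | _        = there (all (trans (set-other f false λ { (r , _) → p≢x r }) e))
    only′ : ∀ {p q} → (p , q) ∈ (x , y) ∷ es → f p q ≡ true
    only′ (here refl) = fxy
    only′ (there e∈)  = set-false⇒ f x y (only e∈)

module _ {n : ℕ} (D : Digraph n) where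

  data Walk : Fin n → Fin n → List (Edge n) → Set where
    []  : ∀ {x} → Walk x x []
    _∷_ : ∀ {x y z es} → Arc D x y → Walk y z es → Walk x z ((x , y) ∷ es)

  -- Nonempty by construction, so that every trail visits some vertex.
  data Closed : List (Edge n) → Set where
    closed : ∀ {x e es} → Walk x x (e ∷ es) → Closed (e ∷ es)

module _ {n : ℕ} {D : Digraph n} where

  _++ʷ_ : ∀ {x y z es fs} → Walk D x y es → Walk D y z fs → Walk D x z (es ++ fs)
  []      ++ʷ w = w
  (a ∷ v) ++ʷ w = a ∷ (v ++ʷ w)

  split-at : ∀ {x z p v es} → Walk D x z es → (p , v) ∈ es →
             ∃₂ λ as bs → es ≡ as ++ (p , v) ∷ bs × Walk D x p as × Arc D p v × Walk D v z bs
  split-at (a ∷ w) (here refl) = [] , _ , refl , [] , a , w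
  split-at (a ∷ w) (there e∈) with as , bs , refl , w₁ , a′ , w₂ ← split-at w e∈ =
    _ , _ , refl , a ∷ w₁ , a′ , w₂

  rotate : ∀ {p v es} → Closed D es → (p , v) ∈ es →
           ∃ λ bs → Walk D v p bs × Arc D p v × es ↭ (p , v) ∷ bs
  rotate (closed w) e∈ with as , bs , eq , w₁ , a , w₂ ← split-at w e∈ =
    bs ++ as , w₂ ++ʷ w₁ , a , ↭-trans (↭-reflexive eq) (++-comm-↭ as (_ ∷ bs))

  end-visited : ∀ {x z es} → Walk D x z es → z ≡ x ⊎ Visits es z
  end-visited [] = inj₁ refl
  end-visited (a ∷ w) with end-visited w
  ... | inj₁ refl = inj₂ (here refl)
  ... | inj₂ v    = inj₂ (there v)

  tail-visited : ∀ {es p v} → Closed D es → (p , v) ∈ es → Visits es p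
  tail-visited c e∈ with bs , w , _ , es↭ ← rotate c e∈ with end-visited w
  ... | inj₁ refl = head-visited e∈
  ... | inj₂ p∈ with q , e′∈ ← visit⇒arc p∈ = head-visited (∈-resp-↭ (↭-sym es↭) (there e′∈))

  Decomposition : ArcSet n → Fin n → Fin n → Set
  Decomposition f x z =
    ∃₂ λ es trails → Walk D x z es × All (Closed D) trails × (es ++ concat trails) enumerates f

  -- The arcs of f are the remainder of a walk to z that has got as far as x.
  decompose : ∀ k f x z → sum (out f) ≤ k → (∀ {p q} → f p q ≡ true → Arc D p q) →
              (∀ v → out f v + δ v z ≡ inn f v + δ v x) → Decomposition f x z
  decompose k f x z size sub bal with x ≟F z
  ... | yes refl with any? (λ p → any? (λ q → f p q ≟B true))
  ...   | no none = [] , [] , [] , [] , [] , (λ {p} {q} e → contradiction (p , q , e) none) , λ ()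
  -- The walk has closed up but arcs remain, and they are balanced. Any of them, `(p , q)`, starts a
  -- new trail whose remainder is a walk from `q` to `p`.
  ...   | yes (p , q , fpq) = next k (subst (_≤ k) (sum-out f fpq) size)
    where
    f′ = set f p q false
    bal′ : ∀ v → out f′ v + δ v p ≡ inn f′ v + δ v q
    bal′ v = trans (sym (out-+arc (set-false f fpq) v))
               (trans (+-cancelʳ-≡ (δ v z) _ _ (bal v)) (inn-+arc (set-false f fpq) v))
    next : ∀ k → suc (sum (out f′)) ≤ k → Decomposition f x z
    next (suc k) (s≤s size′)
      with es , trails , w , cs , enum ← decompose k f′ q p size′ (sub ∘ set-false⇒ f p q) bal′ =
      [] , ((p , q) ∷ es) ∷ trails , [] , closed (sub fpq ∷ w) ∷ cs , enumerates-∷ fpq enum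
  -- Away from `z`, balance gives `x` one more outgoing than incoming arc of `f`, so the walk can go
  -- on.
  decompose k f x z size sub bal | no x≢z with sum-pos⁻¹ (f x) out-x
    where
    out-x : 1 ≤ out f x
    out-x = ≤-trans (m≤n+m 1 (inn f x)) (≤-reflexive (begin
      inn f x + 1       ≡⟨ cong (inn f x +_) (δ-refl x) ⟨
      inn f x + δ x x   ≡⟨ bal x ⟨
      out f x + δ x z   ≡⟨ cong (out f x +_) (δ-≢ x≢z) ⟩
      out f x + 0       ≡⟨ +-identityʳ _ ⟩
      out f x           ∎))
      where open ≡-Reasoning
  ... | y , fxy = next k (subst (_≤ k) (sum-out f fxy) size)
    where
    f′ = set f x y false
    bal′ : ∀ v → out f′ v + δ v z ≡ inn f′ v + δ v y
    bal′ v = +-cancelʳ-≡ (δ v x) _ _ (begin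
      out f′ v + δ v z + δ v x   ≡⟨ +-assoc (out f′ v) _ _ ⟩
      out f′ v + (δ v z + δ v x) ≡⟨ cong (out f′ v +_) (+-comm (δ v z) _) ⟩
      out f′ v + (δ v x + δ v z) ≡⟨ +-assoc (out f′ v) _ _ ⟨
      out f′ v + δ v x + δ v z   ≡⟨ cong (_+ δ v z) (out-+arc (set-false f fxy) v) ⟨
      out f v + δ v z            ≡⟨ bal v ⟩
      inn f v + δ v x            ≡⟨ cong (_+ δ v x) (inn-+arc (set-false f fxy) v) ⟩
      inn f′ v + δ v y + δ v x   ∎)
      where open ≡-Reasoning
    next : ∀ k → suc (sum (out f′)) ≤ k → Decomposition f x z
    next (suc k) (s≤s size′)
      with es , trails , w , cs , enum ← decompose k f′ y z size′ (sub ∘ set-false⇒ f x y) bal′ =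
      (x , y) ∷ es , trails , sub fxy ∷ w , cs , enumerates-∷ fxy enum

-- Lists up to permutation.

module _ {A : Set} where

  Unique-resp-↭ : ∀ {xs ys : List A} → xs ↭ ys → Unique xs → Unique ys
  Unique-resp-↭ p = PermutationSetoid.Unique-resp-↭ (setoid A) (↭⇒↭ₛ p)

  Unique-++⁻ʳ : ∀ (xs : List A) {ys} → Unique (xs ++ ys) → Unique ys
  Unique-++⁻ʳ []       u       = u
  Unique-++⁻ʳ (x ∷ xs) (_ ∷ u) = Unique-++⁻ʳ xs u

  ∈⇒↭ : ∀ {x : A} {xs} → x ∈ xs → ∃ λ ys → xs ↭ x ∷ ys
  ∈⇒↭ x∈ with ps , qs , refl ← ∈-∃++ x∈ = ps ++ qs , shift _ ps qs

  ∈∈⇒↭ : ∀ {x y : A} {xs} → x ∈ xs → y ∈ xs → x ≢ y → ∃ λ zs → xs ↭ x ∷ y ∷ zs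
  ∈∈⇒↭ x∈ y∈ x≢y with ys , p ← ∈⇒↭ x∈ with ∈-resp-↭ p y∈
  ... | here refl  = contradiction refl x≢y
  ... | there y∈ys with zs , q ← ∈⇒↭ y∈ys = zs , ↭-trans p (↭-prep _ q)

  concat-↭ : ∀ {xss yss : List (List A)} → xss ↭ yss → concat xss ↭ concat yss
  concat-↭ _↭_.refl           = ↭-refl
  concat-↭ (_↭_.prep xs p)    = ++⁺ˡ xs (concat-↭ p)
  concat-↭ (_↭_.swap xs ys p) = ↭-trans (shifts xs ys) (++⁺ˡ ys (++⁺ˡ xs (concat-↭ p)))
  concat-↭ (_↭_.trans p q)    = ↭-trans (concat-↭ p) (concat-↭ q)

  -- x ∷ y ∷ (bs ++ as) is the common normal form of two opened trails and of the trail made from them.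
  join-↭ : ∀ {x y : A} {xs ys as bs} → xs ↭ x ∷ as → ys ↭ y ∷ bs → xs ++ ys ↭ x ∷ y ∷ (bs ++ as)
  join-↭ {x} {y} {as = as} {bs} p q =
    ↭-trans (++⁺ p q) (↭-prep x (↭-trans (shift y as bs) (↭-prep y (++-comm-↭ as bs))))

  AllPairs-∈ : ∀ {R : Rel A 0ℓ} {xs x y} → AllPairs R xs → x ∈ xs → y ∈ xs → x ≡ y ⊎ R x y ⊎ R y x
  AllPairs-∈ (r ∷ rs) (here refl) (here refl) = inj₁ refl
  AllPairs-∈ (r ∷ rs) (here refl) (there y∈)  = inj₂ (inj₁ (All.lookup r y∈))
  AllPairs-∈ (r ∷ rs) (there x∈)  (here refl) = inj₂ (inj₂ (All.lookup r x∈))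
  AllPairs-∈ (r ∷ rs) (there x∈)  (there y∈)  = AllPairs-∈ rs x∈ y∈

-- Cycles in a relation where every vertex has a successor.

module _ {n : ℕ} {D : Digraph n} {R : Rel (Fin n) 0ℓ} (R⇒Arc : ∀ {x y} → R x y → Arc D x y) where

  -- The last clause keeps arcs distinct: a new first arc has a tail outside `xs`, and an arc
  -- leaving `t` can later close the walk because no arc of the walk has tail `t`.
  path⇒walk : ∀ {t x xs} → SimplePath R t x xs → t ∈ xs × ∃ λ es → Walk D x t es × Unique es
    × All (λ (p , q) → R p q) es × All (λ e → proj₁ e ∈ xs × proj₁ e ≢ t) es
  path⇒walk stop = here refl , [] , [] , [] , [] , []
  path⇒walk (step {x} {y} r x∉ p) with t∈ , es , w , uniq , rs , tails ← path⇒walk p =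
    there t∈ , (x , y) ∷ es , R⇒Arc r ∷ w
    , All.map (λ { (e∈ , _) refl → x∉ e∈ }) tails ∷ uniq
    , r ∷ rs
    , (here refl , λ { refl → x∉ t∈ }) ∷ All.map (λ (e∈ , e≢) → there e∈ , e≢) tails

  module _ (next : ∀ x → ∃ (R x)) (x₀ : Fin n) where

    orbit : ℕ → Fin n
    orbit zero    = x₀
    orbit (suc k) = proj₁ (next (orbit k))

    orbit-path : ∀ {i j} → i ≤′ j → Star R (orbit i) (orbit j)
    orbit-path ≤′-refl             = ε
    orbit-path (≤′-step {n = k} p) = orbit-path p ◅◅ (proj₂ (next (orbit k)) ◅ ε)

    -- By pigeonhole the orbit returns to some vertex. The path back from that vertex's successor is
    -- made simple, and the arc to the successor closes it.
    cycle : ∃ λ es → Closed D es × Unique es × All (λ (p , q) → R p q) es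
    cycle with i , j , i<j , eq ← pigeonhole (n<1+n n) (orbit ∘ toℕ)
      with xs , path ← simplify _≟F_ (subst (Star R _) (sym eq) (orbit-path (≤⇒≤′ i<j)))
      with _ , es , w , uniq , rs , tails ← path⇒walk path
      with r ← proj₂ (next (orbit (toℕ i))) =
      _ , closed (R⇒Arc r ∷ w) , All.map (λ { (_ , e≢) refl → e≢ refl }) tails ∷ uniq , r ∷ rs

-- Families of arc-disjoint closed trails and operations on them.

module _ {n : ℕ} where

  Share : List (Edge n) → List (Edge n) → Set
  Share A B = Any (λ e → Visits B (proj₂ e)) A

  share⇒ : ∀ {A B v} → Visits A v → Visits B v → Share A B
  share⇒ A∋v B∋v with _ , e∈ ← visit⇒arc A∋v = lose e∈ B∋v

  share⇐ : ∀ {A B} → Share A B → ∃ λ v → Visits A v × Visits B v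
  share⇐ s with (_ , v) , e∈ , B∋v ← find s = v , head-visited e∈ , B∋v

  share? : ∀ A B → Dec (Share A B)
  share? A B = anyElem? (λ e → visits? B (proj₂ e)) A

  disjoint? : ∀ ts → AllPairs (λ A B → ¬ Share A B) ts
            ⊎ ∃₂ λ A B → ∃ λ rest → ts ↭ A ∷ B ∷ rest × Share A B
  disjoint? [] = inj₁ []
  disjoint? (A ∷ ts) with anyElem? (share? A) ts
  ... | yes found with B , B∈ , s ← find found with rest , p ← ∈⇒↭ B∈ = inj₂ (A , B , rest , ↭-prep A p , s)
  ... | no none with disjoint? ts
  ...   | inj₁ dis = inj₁ (All.tabulate (λ B∈ s → none (lose B∈ s)) ∷ dis)
  ...   | inj₂ (B , C , rest , p , s) =
    inj₂ (B , C , A ∷ rest , ↭-trans (↭-prep A p) (↭-trans (↭-swap A B ↭-refl) (↭-prep B (↭-swap A C ↭-refl))) , s)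

module _ {n : ℕ} (D : Digraph n) where

  record Family (trails : List (List (Edge n))) : Set where
    field
      all-closed : All (Closed D) trails
      unique     : Unique (concat trails)
      covers     : ∀ v → ∃ λ u → (u , v) ∈ concat trails

  Cross : List (List (Edge n)) → Fin n → Fin n → Set
  Cross trails x y = ¬ Any (λ t → Visits t x × Visits t y) trails

  cross? : ∀ trails x y → Dec (Cross trails x y)
  cross? trails x y = ¬? (anyElem? (λ t → visits? t x ×-dec visits? t y) trails)

  Smaller : List (List (Edge n)) → Set
  Smaller trails = ∃ λ trails′ → Family trails′ × length trails′ < length trails

module _ {n : ℕ} {D : Digraph n} where
  open Family

  family-resp-↭ : ∀ {ts us} → ts ↭ us → Family D ts → Family D us
  family-resp-↭ p F = record
    { all-closed = All-resp-↭ p (all-closed F)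
    ; unique     = Unique-resp-↭ (concat-↭ p) (unique F)
    ; covers     = λ v → let u , e∈ = covers F v in u , ∈-resp-↭ (concat-↭ p) e∈
    }

  smaller : ∀ {ts A B C rest} → ts ↭ A ∷ B ∷ rest → Family D (C ∷ rest) → Smaller D ts
  smaller {C = C} {rest} p F = C ∷ rest , F , ≤-reflexive (sym (↭-length p))

  -- C is obtained from A and B by trading the arcs del for the arcs new.
  exchange : ∀ {A B C rest new del keep} → Family D (A ∷ B ∷ rest) → Closed D C →
             A ++ B ↭ del ++ keep → C ↭ new ++ keep → Unique new →
             (∀ {e} → e ∈ new → e ∉ concat (A ∷ B ∷ rest)) →
             (∀ {p v} → (p , v) ∈ del → Visits new v) → Family D (C ∷ rest)
  exchange {A} {B} {C} {rest} {new} {del} {keep} F c AB C↭ uniq fresh del⇒new = record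
    { all-closed = c ∷ rest-closed (all-closed F)
    ; unique = Unique-resp-↭ (↭-sym C-all) (Unique.++⁺ uniq
        (Unique-++⁻ʳ del (Unique-resp-↭ old (unique F)))
        λ (e∈new , e∈) → fresh e∈new (∈-resp-↭ (↭-sym old) (∈-++⁺ʳ del e∈)))
    ; covers = covers′
    }
    where
    rest-closed : All (Closed D) (A ∷ B ∷ rest) → All (Closed D) rest
    rest-closed (_ ∷ _ ∷ cs) = cs
    old : concat (A ∷ B ∷ rest) ↭ del ++ (keep ++ concat rest)
    old = ↭-trans (↭-reflexive (sym (++-assoc A B (concat rest))))
            (↭-trans (++⁺ʳ (concat rest) AB) (↭-reflexive (++-assoc del keep (concat rest))))
    C-all : C ++ concat rest ↭ new ++ (keep ++ concat rest)
    C-all = ↭-trans (++⁺ʳ (concat rest) C↭) (↭-reflexive (++-assoc new keep (concat rest)))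
    covers′ : ∀ v → ∃ λ u → (u , v) ∈ C ++ concat rest
    covers′ v with u , e∈ ← covers F v with ∈-++⁻ del (∈-resp-↭ old e∈)
    ... | inj₂ e∈keep = u , ∈-resp-↭ (↭-sym C-all) (∈-++⁺ʳ new e∈keep)
    ... | inj₁ e∈del with q , q∈ ← visit⇒arc (del⇒new e∈del) = q , ∈-resp-↭ (↭-sym C-all) (∈-++⁺ˡ q∈)

  -- Both trails are opened at `v` and run one after the other. The permutation is returned so that
  -- visits of `A` and `B` carry over to `C`.
  splice : ∀ {A B rest v} → Family D (A ∷ B ∷ rest) → Visits A v → Visits B v →
           ∃ λ C → Family D (C ∷ rest) × C ↭ A ++ B
  splice {A} {B} F A∋v B∋v with closed-AB (all-closed F)
    where
    closed-AB : ∀ {rest} → All (Closed D) (A ∷ B ∷ rest) → Closed D A × Closed D B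
    closed-AB (a ∷ b ∷ _) = a , b
  ... | cA , cB
    with p , pv∈ ← visit⇒arc A∋v | q , qv∈ ← visit⇒arc B∋v
    with as , wA , pv , A↭ ← rotate cA pv∈ | bs , wB , qv , B↭ ← rotate cB qv∈ =
    _ , exchange {new = []} {del = []} F (closed (pv ∷ (wB ++ʷ (qv ∷ wA)))) ↭-refl C↭ [] (λ ()) (λ ()) , C↭
    where
    C↭ = ↭-trans (↭-prep _ (shift _ bs as)) (↭-sym (join-↭ A↭ B↭))

  visitor : ∀ {ts} → Family D ts → ∀ v → ∃ λ t → t ∈ ts × Visits t v
  visitor {ts} F v with u , e∈ ← covers F v with t , e∈t , t∈ ← ∈-concat⁻′ ts e∈ =
    t , t∈ , head-visited e∈t

  cross-fresh : ∀ {ts x y} → Family D ts → Cross D ts x y → (x , y) ∉ concat ts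
  cross-fresh {ts} F cross e∈ with t , e∈t , t∈ ← ∈-concat⁻′ ts e∈ =
    cross (lose t∈ (tail-visited (All.lookup (all-closed F) t∈) e∈t , head-visited e∈t))

  -- The first arc of `K` joins two different trails `A` and `B`. Adding `K` to the family and
  -- splicing it with `A` and then with `B` turns three trails into one, a net loss of one.
  add-cycle : ∀ {ts K} → Family D ts → Closed D K → Unique K → All (λ (p , q) → Cross D ts p q) K → Smaller D ts
  add-cycle {ts} {K} F cK@(closed {e = x , y} _) uniq crossing@(cross ∷ _)
    with A , A∈ , A∋x ← visitor F x | B , B∈ , B∋y ← visitor F y
    with rest , ts↭ ← ∈∈⇒↭ A∈ B∈ (λ { refl → cross (lose A∈ (A∋x , B∋y)) })
    with FK ← family-resp-↭ (↭-prep K ts↭) record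
           { all-closed = cK ∷ all-closed F
           ; unique = Unique.++⁺ uniq (unique F) λ (e∈K , e∈) → cross-fresh F (All.lookup crossing e∈K) e∈
           ; covers = λ v → let u , e∈ = covers F v in u , ∈-++⁺ʳ K e∈ }
    with C , FC , C↭ ← splice FK (tail-visited cK (here refl)) A∋x
    with C′ , FC′ , _ ← splice FC (Any-resp-↭ (↭-sym C↭) (here refl)) B∋y
    = smaller ts↭ FC′

-- Merging trails in a strong semicomplete multipartite digraph.

module Merge {n : ℕ} (D : Digraph n) (strong : Strong D) (smp : SemicompleteMultipartite D) where
  open Digraph D
  open Multipartite D smp
  open Family

  module Disjoint {T₁ T₂ : List (Edge n)} {ts₀ : List (List (Edge n))} (F : Family D (T₁ ∷ T₂ ∷ ts₀))
    (disjoint : AllPairs (λ A B → ¬ Share A B) (T₁ ∷ T₂ ∷ ts₀)) where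

    ts : List (List (Edge n))
    ts = T₁ ∷ T₂ ∷ ts₀

    same-trail : ∀ {A B v} → A ∈ ts → B ∈ ts → Visits A v → Visits B v → A ≡ B
    same-trail A∈ B∈ A∋v B∋v with AllPairs-∈ disjoint A∈ B∈
    ... | inj₁ eq         = eq
    ... | inj₂ (inj₁ ¬AB) = contradiction (share⇒ A∋v B∋v) ¬AB
    ... | inj₂ (inj₂ ¬BA) = contradiction (share⇒ B∋v A∋v) ¬BA

    cross-trails : ∀ {A B x y} → A ∈ ts → B ∈ ts → A ≢ B → Visits A x → Visits B y → Cross D ts x y
    cross-trails A∈ B∈ A≢B A∋x B∋y c with t , t∈ , t∋x , t∋y ← find c =
      A≢B (trans (same-trail A∈ t∈ A∋x t∋x) (same-trail t∈ B∈ t∋y B∋y))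

    HasExit : Fin n → Set
    HasExit x = ∃ λ y → Arc D x y × Cross D ts x y

    hasExit? : ∀ x → Dec (HasExit x)
    hasExit? x = any? (λ y → (arc x y ≟B true) ×-dec cross? D ts x y)

    -- The arc (u , s) is replaced by a detour through all of B: along (u , b), around B, and back
    -- to s either from b itself or, when b and s are nonadjacent, from the predecessor of b.
    detour : ∀ {A u s} → A ∈ ts → (u , s) ∈ A → HasExit u → ¬ HasExit s → Smaller D ts
    detour {A} {u} {s} A∈ us∈ (b , ub , cross) ¬exit
      with B , B∈ , B∋b ← visitor F b
      with b′ , b′b∈ ← visit⇒arc B∋b = result
      where
      cA = All.lookup (all-closed F) A∈
      cB = All.lookup (all-closed F) B∈
      A∋u = tail-visited cA us∈
      A∋s = head-visited us∈
      B∋b′ = tail-visited cB b′b∈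
      A≢B : A ≢ B
      A≢B refl = cross (lose A∈ (A∋u , B∋b))

      distinct : ∀ {x y} → Visits A x → Visits B y → x ≢ y
      distinct A∋x B∋x refl = A≢B (same-trail A∈ B∈ A∋x B∋x)

      -- An arc from `s` to a vertex of `B` would be an exit of `s`, so adjacency can only give the
      -- reverse arc.
      into-s : ∀ {y} → Visits B y → part y ≢ part s → Arc D y s
      into-s B∋y ne with adjacent ne
      ... | inj₁ ys = ys
      ... | inj₂ sy = contradiction (_ , sy , cross-trails A∈ B∈ A≢B A∋s B∋y) ¬exit

      result : Smaller D ts
      result with rest , ts↭ ← ∈∈⇒↭ A∈ B∈ A≢B
        with as , wA , us , A↭ ← rotate cA us∈
        with bs , wB , b′b , B↭ ← rotate cB b′b∈ with part b ≟ℕ part s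
      ... | no ne = smaller ts↭ (exchange {new = (u , b) ∷ (b , s) ∷ []} {del = (u , s) ∷ []}
              (family-resp-↭ ts↭ F)
              (closed (ub ∷ (wB ++ʷ (b′b ∷ bs-arc ∷ wA))))
              (join-↭ A↭ B↭)
              (↭-prep _ (↭-trans (shift (b′ , b) bs _)
                 (↭-trans (↭-prep _ (shift (b , s) bs as)) (↭-swap _ _ ↭-refl))))
              (((λ { refl → distinct A∋u B∋b refl }) ∷ []) ∷ [] ∷ [])
              (λ { (here refl) → fresh cross
                 ; (there (here refl)) → fresh (cross-trails B∈ A∈ (≢-sym A≢B) B∋b A∋s) })
              (λ { (here refl) → there (here refl) }))
        where
        bs-arc = into-s B∋b ne
        fresh : ∀ {x y} → Cross D ts x y → (x , y) ∉ concat (A ∷ B ∷ rest)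
        fresh c e∈ = cross-fresh F c (∈-resp-↭ (↭-sym (concat-↭ ts↭)) e∈)
      -- `b` lies in the part of `s`, so its predecessor `b′` does not. The arcs `(u , s)` and
      -- `(b′ , b)` exchange heads, which keeps both `s` and `b` visited.
      ... | yes eq = smaller ts↭ (exchange {new = (u , b) ∷ (b′ , s) ∷ []} {del = (u , s) ∷ (b′ , b) ∷ []}
              (family-resp-↭ ts↭ F)
              (closed (ub ∷ (wB ++ʷ (b′s ∷ wA))))
              (join-↭ A↭ B↭)
              (↭-prep _ (shift (b′ , s) bs as))
              (((λ { refl → distinct A∋s B∋b refl }) ∷ []) ∷ [] ∷ [])
              (λ { (here refl) → fresh cross
                 ; (there (here refl)) → fresh (cross-trails B∈ A∈ (≢-sym A≢B) B∋b′ A∋s) })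
              (λ { (here refl) → there (here refl) ; (there (here refl)) → here refl }))
        where
        b′s = into-s B∋b′ (λ eq′ → arc⇒≢part b′b (trans eq′ (sym eq)))
        fresh : ∀ {x y} → Cross D ts x y → (x , y) ∉ concat (A ∷ B ∷ rest)
        fresh c e∈ = cross-fresh F c (∈-resp-↭ (↭-sym (concat-↭ ts↭)) e∈)

    -- Scanning back from `z`, the first vertex met that has an exit is followed by one without.
    last-exit : ∀ {x z es} → Walk D x z es → ¬ HasExit z →
                (∃₂ λ u s → (u , s) ∈ es × HasExit u × ¬ HasExit s)
                ⊎ (¬ HasExit x × (∀ {v} → Visits es v → ¬ HasExit v))
    last-exit [] ¬z = inj₂ (¬z , λ ())
    last-exit (_∷_ {x} a w) ¬z with last-exit w ¬z
    ... | inj₁ (u , s , e∈ , h) = inj₁ (u , s , there e∈ , h)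
    ... | inj₂ (¬y , none) with hasExit? x
    ...   | yes exit = inj₁ (_ , _ , here refl , exit , ¬y)
    ...   | no ¬x    = inj₂ (¬x , λ { (here refl) → ¬y ; (there v∈) → none v∈ })

    -- A trail visiting a vertex of `T₁` and one of `T₂` would equal both by disjointness, making
    -- `T₁` share a vertex with `T₂`.
    unvisited : ∀ {A} → A ∈ ts → ∃ λ b → ¬ Visits A b
    unvisited {A} A∈ with all-closed F
    ... | closed {e = _ , h₁} _ ∷ closed {e = _ , h₂} _ ∷ _
      with visits? A h₁ | visits? A h₂
    ...   | no ¬h₁ | _ = h₁ , ¬h₁
    ...   | yes _ | no ¬h₂ = h₂ , ¬h₂
    ...   | yes A∋h₁ | yes A∋h₂ = contradiction
      (share⇒ (here refl) (subst (λ t → Visits t h₁) T₁≡T₂ (here refl)))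
      (All.head (AllPairs.head disjoint))
      where
      T₁≡T₂ : T₁ ≡ T₂
      T₁≡T₂ = trans (same-trail (here refl) A∈ (here refl) A∋h₁)
                    (same-trail A∈ (there (here refl)) A∋h₂ (here refl))

    -- `A` misses a vertex, so by strong connectivity some arc leaves its vertex set, and the tail
    -- of that arc has an exit.
    some-exit : ∀ {A a} → A ∈ ts → Visits A a → ¬ (∀ v → Visits A v → ¬ HasExit v)
    some-exit {A} {a} A∈ A∋a none with b , A∌b ← unvisited A∈
      with p , q , pq , Pp , Pq ← leaving D (λ v → does (visits? A v)) (strong a b)
             (dec-true (visits? A a) A∋a) (dec-false (visits? A b) A∌b)
      with visits? A p | visits? A q
    ... | yes A∋p | no A∌q with B , B∈ , B∋q ← visitor F q =
      none p A∋p (q , pq , cross-trails A∈ B∈ (λ { refl → A∌q B∋q }) A∋p B∋q)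

    reduce : Smaller D ts
    reduce with all? hasExit?
    ... | yes exits with closed {x = x} _ ∷ _ ← all-closed F
      with es , c , uniq , rs ← cycle {D = D} {R = λ x y → Arc D x y × Cross D ts x y} proj₁ exits x =
      add-cycle F c uniq (All.map proj₂ rs)
    reduce | no ¬exits with s , ¬s ← ¬∀⟶∃¬ n HasExit hasExit? ¬exits
      with A , A∈ , A∋s ← visitor F s with u , us∈ ← visit⇒arc A∋s with hasExit? u
    ... | yes exit = detour A∈ us∈ exit ¬s
    -- Opened at `(u , s)`, the trail becomes a walk ending at `u`, which has no exit either, so the
    -- whole trail can be scanned backwards.
    ... | no ¬u with as , w , us , A↭ ← rotate (All.lookup (all-closed F) A∈) us∈
      with last-exit (us ∷ w) ¬u
    ...   | inj₁ (u′ , s′ , e∈ , exit , ¬s′) = detour A∈ (∈-resp-↭ (↭-sym A↭) e∈) exit ¬s′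
    ...   | inj₂ (_ , none) = contradiction (λ v A∋v → none (Any-resp-↭ A↭ A∋v)) (some-exit A∈ A∋s)

  -- Induction on the number of trails, bounded by `k`: trails with a common vertex are spliced,
  -- disjoint ones reduced. The given vertex rules out the empty family, which covers nothing.
  merge : ∀ k ts → length ts ≤ k → Family D ts → Fin n → ∃ λ A → Family D [ A ]
  merge k [] _ F v with () ← proj₂ (covers F v)
  merge k (A ∷ []) _ F v = A , F
  merge (suc k) ts@(_ ∷ _ ∷ _) size F v with disjoint? ts
  ... | inj₁ disjoint with ts′ , F′ , less ← Disjoint.reduce F disjoint =
    merge k ts′ (≤-pred (≤-trans less size)) F′ v
  ... | inj₂ (A , B , rest , ts↭ , s) with w , A∋w , B∋w ← share⇐ s
    with C , F′ , _ ← splice (family-resp-↭ ts↭ F) A∋w B∋w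
    with ts′ , F″ , less ← smaller ts↭ F′ = merge k ts′ (≤-pred (≤-trans less size)) F″ v

  -- From an eulerian factor to a spanning closed trail.

  factor⇒supereulerian : ∀ {f} → Balanced D f → (∀ v → 1 ≤ out f v) → Fin n → Supereulerian D
  factor⇒supereulerian {f} B covered v₀
    with es , trails , w , cs , enum ← decompose {D = D} _ f v₀ v₀ ≤-refl (Balanced.sub B)
                                      (λ v → cong (_+ δ v v₀) (sym (Balanced.bal B v)))
    = finish (merge _ (proj₁ family) ≤-refl (proj₂ family) v₀)
    where
    covers′ : ∀ v → ∃ λ u → (u , v) ∈ es ++ concat trails
    covers′ v with u , fuv ← sum-pos⁻¹ (λ u → f u v) (subst (1 ≤_) (sym (Balanced.bal B v)) (covered v)) =
      u , proj₁ (proj₂ enum) fuv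

    -- The walk from `v₀` to `v₀` may be empty, and then it is not a `Closed` trail and must be left
    -- out of the family.
    add-initial : ∀ {es} → Walk D v₀ v₀ es → Unique (es ++ concat trails) →
             (∀ v → ∃ λ u → (u , v) ∈ es ++ concat trails) → ∃ (Family D)
    add-initial {[]}    w u c = trails , record { all-closed = cs ; unique = u ; covers = c }
    add-initial {_ ∷ _} w u c = _ ∷ trails , record { all-closed = closed w ∷ cs ; unique = u ; covers = c }

    family : ∃ (Family D)
    family = add-initial w (proj₁ enum) covers′

    arcsOf-walk : ∀ {x z es} → Walk D x z es → arcsOf D x (map proj₂ es) ≡ es
    arcsOf-walk []      = refl
    arcsOf-walk (_ ∷ w) = cong (_ ∷_) (arcsOf-walk w)

    endpoint-walk : ∀ {x z es} → Walk D x z es → endpoint D x (map proj₂ es) ≡ z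
    endpoint-walk []      = refl
    endpoint-walk (_ ∷ w) = endpoint-walk w

    walk-arcs : ∀ {x z es} → Walk D x z es → All (λ (p , q) → Arc D p q) es
    walk-arcs []      = []
    walk-arcs (a ∷ w) = a ∷ walk-arcs w

    finish : (∃ λ A → Family D [ A ]) → Supereulerian D
    finish (A , F) with closed {x} w ∷ [] ← all-closed F =
      x , map proj₂ A
      , ( subst (All _) (sym (arcsOf-walk w)) (walk-arcs w)
        , subst Unique (trans (++-identityʳ A) (sym (arcsOf-walk w))) (unique F)
        , endpoint-walk w)
      , λ v → let u , uv∈ = covers F v in there (∈-map⁺ proj₂ (subst ((u , v) ∈_) (++-identityʳ A) uv∈))

theorem2 : (n : ℕ) (D : Digraph n) →
    1 ≤ n →
    Strong D →
    SemicompleteMultipartite D →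
    (∀ (u v : Fin n) → Nonadjacent D u v → Dominated D u v →
    2 * n ≤ deg D u + deg D v + 3) →
    Supereulerian D
-- A single vertex has no arcs and so no eulerian factor; the empty trail serves instead.
theorem2 1 D _ _ _ _ = zero , [] , ([] , [] , refl) , λ { zero → here refl }
theorem2 (suc (suc n)) D _ strong smp degs =
  let f , B , covered = Factor.eulerianFactor D strong smp degs inNbr
  in Merge.factor⇒supereulerian D strong smp B covered zero
  where
  inNbr : ∀ y → ∃ λ w → Arc D w y
  inNbr zero    = Factor.inNeighbour D strong smp degs zero {suc zero} λ ()
  inNbr (suc y) = Factor.inNeighbour D strong smp degs (suc y) {zero} λ ()
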